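{- Let $(X,\mathcal{I})$ be a Polish ideal space such that every set in $\mathcal{B}_+(X)$ contains an $\mathcal{I}$-positive closed set. Suppose $\mathcal{A}$ is a strongly Borel measurable partition of $X$ into $\mathcal{I}$-null closed sets. Then there is a subfamily $\mathcal{A}_0\subseteq\mathcal{A}$ such that $\bigcup\mathcal{A}_0$ is completely $\mathcal{I}$-nonmeasurable.
   Context: $\mathcal{B}(X)$ is the Borel $\sigma$-algebra of $X$. A pair $(X,\mathcal{I})$ is a Polish ideal space if $X$ is an uncountable Polish space and $\mathcal{I}$ is a proper $\sigma$-ideal of subsets of $X$ that contains all singletons and has a Borel base, i.e. every $A\in\mathcal{I}$ is contained in a Borel set belonging to $\mathcal{I}$. Sets in $\mathcal{I}$ are called $\mathcal{I}$-null; subsets of $X$ not in $\mathcal{I}$ are called $\mathcal{I}$-positive. Put $\mathcal{B}_+(X)=\mathcal{B}(X)\setminus\mathcal{I}$. A set $A\subseteq X$ is completely $\mathcal{I}$-nonmeasurable if for every $B\in\mathcal{B}_+(X)$ both $A\cap B\neq\emptyset$ and $(X\setminus A)\cap B\neq\emptyset$. For a partition $\pi$ of $X$ and $A\subseteq X$, the saturation of $A$ is $A^*=\bigcup\{E\in\pi: E\cap A\neq\emptyset\}$. The partition $\pi$ is strongly Borel measurable if the saturation of every closed subset of $X$ is Borel. -}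

module Defs where

open import Agda.Primitive using (Setω)
open import Level using (Level; 0ℓ; suc; _⊔_; Lift)
open import Axiom.ExcludedMiddle using (ExcludedMiddle)
open import Axiom.Extensionality.Propositional using (Extensionality)
open import Data.Nat.Base as ℕ using (ℕ)
open import Data.Product.Base using (Σ; ∃; ∃-syntax; _×_; _,_)
open import Data.Rational.Base using (ℚ; 0ℚ; 1ℚ; _+_; _<_; _≤_)
import Data.Rational.Properties as ℚ
open import Data.Unit.Base using (⊤)
open import Function.Bundles using (_⇔_; _↣_)
open import Relation.Binary.PropositionalEquality.Core using (_≡_)
open import Relation.Nullary.Negation.Core using (¬_)
open import Relation.Unary
  using (Pred; _∈_; _⊆_; _≐_; _≬_; ∁; _∩_; ⋃; ｛_｝; Satisfiable; Empty; Universal)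

private
  variable
    ℓ : Level

-- A real number x is represented by its open upper Dedekind cut
-- { q ∈ ℚ ∣ x < q }.  With excluded middle these are exactly the classical
-- reals (no separate lower cut is needed); equality of reals is _≃ᵣ_, not _≡_.
record ℝ : Set₁ where
  field
    upper     : Pred ℚ 0ℓ
    inhabited : Satisfiable upper
    bounded   : ∃[ b ] (∀ {q} → q ∈ upper → b ≤ q)
    up-closed : ∀ {q r} → q ≤ r → q ∈ upper → r ∈ upper
    rounded   : ∀ {q} → q ∈ upper → ∃[ r ] (r < q × r ∈ upper)

open ℝ public

infix 4 _≤ᵣ_ _≃ᵣ_ _<ᵣ_
infixl 6 _+ᵣ_

_≤ᵣ_ : ℝ → ℝ → Set
x ≤ᵣ y = upper y ⊆ upper x

_≃ᵣ_ : ℝ → ℝ → Set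
x ≃ᵣ y = upper x ≐ upper y

_<ᵣ_ : ℝ → ℚ → Set
x <ᵣ q = q ∈ upper x

0ᵣ : ℝ
0ᵣ .upper q       = 0ℚ < q
0ᵣ .inhabited     = 1ℚ , ℚ.positive⁻¹ 1ℚ
0ᵣ .bounded       = 0ℚ , ℚ.<⇒≤
0ᵣ .up-closed q≤r 0<q = ℚ.<-≤-trans 0<q q≤r
0ᵣ .rounded 0<q with ℚ.<-dense 0<q
... | r , 0<r , r<q = r , r<q , 0<r

_+ᵣ_ : ℝ → ℝ → ℝ
(x +ᵣ y) .upper q = ∃[ r ] ∃[ s ] (r ∈ upper x × s ∈ upper y × r + s ≤ q)
(x +ᵣ y) .inhabited with inhabited x | inhabited y
... | r , r∈x | s , s∈y = r + s , r , s , r∈x , s∈y , ℚ.≤-refl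
(x +ᵣ y) .bounded with bounded x | bounded y
... | b , b≤ | c , c≤ =
  b + c , λ { (_ , _ , r∈x , s∈y , r+s≤q) →
                ℚ.≤-trans (ℚ.+-mono-≤ (b≤ r∈x) (c≤ s∈y)) r+s≤q }
(x +ᵣ y) .up-closed q≤q′ (r , s , r∈x , s∈y , r+s≤q) =
  r , s , r∈x , s∈y , ℚ.≤-trans r+s≤q q≤q′
(x +ᵣ y) .rounded (r , s , r∈x , s∈y , r+s≤q) with rounded x r∈x
... | r′ , r′<r , r′∈x =
  r′ + s , ℚ.<-≤-trans (ℚ.+-monoˡ-< s r′<r) r+s≤q , r′ , s , r′∈x , s∈y , ℚ.≤-refl

record Metric (X : Set ℓ) : Set (ℓ ⊔ suc 0ℓ) where
  field
    d        : X → X → ℝ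
    nonneg   : ∀ x y → 0ᵣ ≤ᵣ d x y
    zero⇔≡   : ∀ x y → (d x y ≃ᵣ 0ᵣ) ⇔ (x ≡ y)
    symm     : ∀ x y → d x y ≃ᵣ d y x
    triangle : ∀ x y z → d x z ≤ᵣ d x y +ᵣ d y z

  Cauchy : Pred (ℕ → X) 0ℓ
  Cauchy s = ∀ ε → 0ℚ < ε → ∃[ N ] (∀ m n → N ℕ.≤ m → N ℕ.≤ n → d (s m) (s n) <ᵣ ε)

  _ConvergesTo_ : (ℕ → X) → X → Set
  s ConvergesTo x = ∀ ε → 0ℚ < ε → ∃[ N ] (∀ n → N ℕ.≤ n → d (s n) x <ᵣ ε)

  Complete : Set ℓ
  Complete = ∀ s → Cauchy s → ∃[ x ] s ConvergesTo x

-- Subsets of X : Set ℓ are predicates in Pred X ℓ, identified up to _≐_;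
-- hence families of subsets are required to respect _≐_.
record Topology (X : Set ℓ) : Set (suc (suc ℓ)) where
  field
    Open        : Pred (Pred X ℓ) (suc ℓ)
    open-resp-≐ : ∀ {U V} → U ≐ V → Open U → Open V
    open-whole  : Open (λ _ → Lift ℓ ⊤)
    open-∩      : ∀ {U V} → Open U → Open V → Open (U ∩ V)
    -- The empty set is the case I = Lift ℓ ⊥.
    open-⋃      : (I : Set ℓ) (U : I → Pred X ℓ) → (∀ i → Open (U i)) → Open (⋃ I U)

  Closed : Pred (Pred X ℓ) (suc ℓ)
  Closed F = Open (∁ F)

  data Borel : Pred X ℓ → Set (suc ℓ) where
    open-set   : ∀ {U} → Open U → Borel U
    complement : ∀ {A} → Borel A → Borel (∁ A)
    union      : (A : ℕ → Pred X ℓ) → (∀ n → Borel (A n)) → Borel (⋃ ℕ A)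
    resp-≐     : ∀ {A B} → A ≐ B → Borel A → Borel B

  Dense : Pred X ℓ → Set (suc ℓ)
  Dense D = ∀ U → Open U → Satisfiable U → D ≬ U

CountableSubset : {X : Set ℓ} → Pred X ℓ → Set ℓ
CountableSubset {X = X} D =
  Σ (X → ℕ) λ f → ∀ {x y} → x ∈ D → y ∈ D → f x ≡ f y → x ≡ y

module _ {X : Set ℓ} (T : Topology X) where
  open Topology T

  Separable : Set (suc ℓ)
  Separable = ∃[ D ] (CountableSubset D × Dense D)

  Induces : Metric X → Set (suc ℓ)
  Induces M = ∀ U → Open U ⇔
      (∀ x → x ∈ U → ∃[ ε ] (0ℚ < ε × (∀ y → d x y <ᵣ ε → y ∈ U)))
    where open Metric M

  IsPolish : Set (suc ℓ)
  IsPolish = Separable × Σ (Metric X) λ M → Metric.Complete M × Induces M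

record PolishIdealSpace (ℓ : Level) : Set (suc (suc ℓ)) where
  field
    X           : Set ℓ
    topology    : Topology X
    polish      : IsPolish topology
    uncountable : ¬ (X ↣ ℕ)

  open Topology topology public

  field
    Null           : Pred (Pred X ℓ) (suc ℓ)
    null-empty     : ∀ {A} → Empty A → Null A
    null-⊆         : ∀ {A B} → A ⊆ B → Null B → Null A
    null-⋃         : (A : ℕ → Pred X ℓ) → (∀ n → Null (A n)) → Null (⋃ ℕ A)
    null-proper    : ¬ (∀ A → Null A)
    null-singleton : ∀ x → Null ｛ x ｝
    null-base      : ∀ A → Null A → ∃[ B ] (Borel B × Null B × A ⊆ B)

  Positive : Pred (Pred X ℓ) (suc ℓ)
  Positive A = ¬ Null A

  Borel₊ : Pred (Pred X ℓ) (suc ℓ)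
  Borel₊ B = Borel B × Positive B

  CompletelyNonmeasurable : Pred (Pred X ℓ) (suc ℓ)
  CompletelyNonmeasurable A = ∀ B → Borel₊ B → A ≬ B × ∁ A ≬ B

-- A partition is given as an indexed family of nonempty, pairwise disjoint sets;
-- these conditions make the indexing injective, so Index stands for the set of
-- pieces and subfamilies are predicates on Index.
record Partition (X : Set ℓ) : Set (suc ℓ) where
  field
    Index    : Set ℓ
    piece    : Index → Pred X ℓ
    nonempty : ∀ i → Satisfiable (piece i)
    disjoint : ∀ {i j} → piece i ≬ piece j → i ≡ j
    covers   : Universal (⋃ Index piece)

  ⋃[_] : Pred Index ℓ → Pred X ℓ
  ⋃[ J ] x = ∃[ i ] (i ∈ J × x ∈ piece i)

  saturation : Pred X ℓ → Pred X ℓ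
  saturation A = ⋃[ (λ i → piece i ≬ A) ]

StronglyBorelMeasurable : {X : Set ℓ} → Topology X → Partition X → Set (suc ℓ)
StronglyBorelMeasurable T π = ∀ F → Closed F → Borel (saturation F)
  where
  open Topology T
  open Partition π

-- The ambient logic is classical set theory.  ExcludedMiddle decides arbitrary
-- types, not only propositions, so it also provides the axiom of choice;
-- Extensionality makes functions (in particular X → Bool) extensional, so that
-- choice functions on power sets are well defined.
record ClassicalSetTheory : Setω where
  field
    excludedMiddle : ∀ {a} → ExcludedMiddle a
    extensionality : ∀ {a b} → Extensionality a b

module Submission where

open import Defs
open import Level as Level using (Level; Lift; lift)
open import Algebra.Properties.AbelianGroup using (xyx⁻¹≈y)
open import Axiom.Extensionality.Propositional using (implicit-extensionality)
open import Data.Bool.Base using (Bool; true; false)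
open import Data.Bool.Properties using (⇔→≡)
open import Data.Empty using (⊥-elim)
open import Data.Integer.Base as ℤ using (+_)
import Data.Integer.Properties as ℤ
open import Data.Nat.Base as ℕ using (ℕ; zero; suc; z≤n; s≤s)
open import Data.Nat.Coprimality using (1-coprimeTo)
import Data.Nat.Properties as ℕ
open import Data.Product.Base using (Σ; ∃; ∃-syntax; _×_; _,_; proj₁; proj₂)
open import Data.Rational.Base as ℚ using (ℚ; mkℚ; 0ℚ; ½; _+_; _-_; _*_; _<_; _≤_; *≤*; *<*)
import Data.Rational.Properties as ℚ
open import Data.Sum.Base using (_⊎_; inj₁; inj₂; [_,_]′)
open import Data.Unit.Base using (⊤)
open import Function.Base using (_∘_; id; _on_)
open import Function.Bundles using (mk⇔; module Equivalence)
open import Function.Definitions using (Injective)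
open import Induction.WellFounded
  using (WellFounded; WfRec; Acc; acc; module All; module FixPoint)
open import Relation.Binary.Core using (Rel)
import Relation.Binary.Construct.On as On
open import Relation.Binary.PropositionalEquality
  using (_≡_; _≢_; refl; sym; trans; cong; subst)
open import Relation.Nullary using (¬_; yes; no; does; contradiction)
open import Relation.Nullary.Decidable using (decidable-stable; dec-true)
open import Relation.Unary
  using (Pred; _∈_; _∉_; _⊆_; _≬_; ∁; _∩_; ⋃; Satisfiable)

-- Fix countably many closed balls such that every point lies in arbitrarily small
-- ones; the pieces being closed, the saturations of these balls separate them, and
-- these saturations are Borel.  A positive closed F cannot have a null side with respect
-- to each of them, since otherwise F would be contained in a single piece up to a
-- null set.  So F splits into two positive Borel sets with disjoint saturations,
-- each containing a positive closed set of small diameter.  Iterating gives a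
-- Cantor scheme, hence an injection of 2^ℕ into the set of pieces meeting F.
-- There are only 2^ℕ closed sets, so a transfinite (Bernstein) construction picks,
-- for every positive closed F, two pieces meeting F, all of them distinct; one
-- piece from each pair is put into the subfamily.

private
  variable
    a b c r ℓ : Level

-- Classical choice and well-orderings.

module Classical (classical : ClassicalSetTheory) where
  open ClassicalSetTheory classical public

  ¬¬-elim : {A : Set a} → ¬ ¬ A → A
  ¬¬-elim = decidable-stable excludedMiddle

  ⌊_⌋ : Set a → Bool
  ⌊ A ⌋ = does (excludedMiddle {P = A})

  ⌊⌋-complete : {A : Set a} → A → ⌊ A ⌋ ≡ true
  ⌊⌋-complete = dec-true excludedMiddle

  ⌊⌋-sound : {A : Set a} → ⌊ A ⌋ ≡ true → A
  ⌊⌋-sound {A = A} eq with excludedMiddle {P = A}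
  ... | yes x = x
  ⌊⌋-sound () | no _

  minimal : {W : Set a} {_<_ : Rel W r} → WellFounded _<_ → (Q : Pred W b) →
            ∃ Q → ∃ λ w → Q w × WfRec _<_ (λ v → ¬ Q v) w
  minimal {_<_ = _<_} wf Q (w , Qw)
    with excludedMiddle {P = ∃ λ w → Q w × WfRec _<_ (λ v → ¬ Q v) w}
  ... | yes least = least
  ... | no none   = contradiction Qw
    (All.wfRec wf _ (λ v → ¬ Q v) (λ v ih Qv → none (v , Qv , ih)) w)

  -- Zermelo's theorem.  The tower is the least family of subsets closed under
  -- adjoining the chosen element of the complement and under unions; it is a
  -- chain, and x precedes y when some member of it contains x but not y.
  module Zermelo {W : Set a} (w₀ : W) where

    Subset : Set a
    Subset = W → Bool

    infix 4 _∈ᵇ_ _∉ᵇ_ _⊑_ _≺_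

    _∈ᵇ_ _∉ᵇ_ : W → Subset → Set
    x ∈ᵇ S = S x ≡ true
    x ∉ᵇ S = ¬ x ∈ᵇ S

    _⊑_ : Rel Subset a
    S ⊑ R = ∀ {x} → x ∈ᵇ S → x ∈ᵇ R

    ⊑-antisym : ∀ {S R} → S ⊑ R → R ⊑ S → S ≡ R
    ⊑-antisym S⊑R R⊑S = extensionality λ _ → ⇔→≡ (mk⇔ S⊑R R⊑S)

    -- Deciding whether a point outside S exists also returns one, so this is a choice function on
    -- complements; `w₀` is the value at the full set only.
    next : Subset → W
    next S with excludedMiddle {P = ∃[ x ] x ∉ᵇ S}
    ... | yes (x , _) = x
    ... | no _        = w₀

    next∉ : ∀ S {x} → x ∉ᵇ S → next S ∉ᵇ S
    next∉ S x∉S with excludedMiddle {P = ∃[ x ] x ∉ᵇ S}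
    ... | yes (_ , y∉S) = y∉S
    ... | no full       = contradiction (_ , x∉S) full

    infix 8 _⁺

    _⁺ : Subset → Subset
    (S ⁺) x = ⌊ x ∈ᵇ S ⊎ x ≡ next S ⌋

    ⊑-⁺ : ∀ S → S ⊑ S ⁺
    ⊑-⁺ S = ⌊⌋-complete ∘ inj₁

    next∈⁺ : ∀ S → next S ∈ᵇ S ⁺
    next∈⁺ S = ⌊⌋-complete (inj₂ refl)

    data Tower : Subset → Set a where
      step  : ∀ {S} → Tower S → Tower (S ⁺)
      union : ∀ {S} → (∀ {x} → x ∈ᵇ S → ∃[ R ] (Tower R × R ⊑ S × x ∈ᵇ R)) → Tower S

    -- The extreme points of the Bourbaki-Witt argument: the successor of a member strictly inside S
    -- never leaves S.
    Extreme : Pred Subset a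
    Extreme S = ∀ {R} → Tower R → R ⊑ S → S ⊑ R ⊎ R ⁺ ⊑ S

    -- Induction on R. If R ⊑ S, extremeness leaves R ⁺ ⊑ S or R = S, and in the latter case R ⁺ = S
    -- ⁺. A union either has a subset containing S ⁺ or has all its members inside S.
    extreme-comparable : ∀ {S} → Extreme S → ∀ {R} → Tower R → R ⊑ S ⊎ S ⁺ ⊑ R
    extreme-comparable {S} ext (step {R} t) with extreme-comparable ext t
    ... | inj₂ S⁺⊑R = inj₂ (⊑-⁺ R ∘ S⁺⊑R)
    ... | inj₁ R⊑S with ext t R⊑S
    ...   | inj₂ R⁺⊑S = inj₁ R⁺⊑S
    ...   | inj₁ S⊑R  = inj₂ (subst (λ Q → S ⁺ ⊑ Q ⁺) (⊑-antisym S⊑R R⊑S) id)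
    extreme-comparable {S} ext {R} (union f)
      with excludedMiddle {P = ∃[ Q ] (S ⁺ ⊑ Q × Q ⊑ R)}
    ... | yes (_ , S⁺⊑Q , Q⊑R) = inj₂ (Q⊑R ∘ S⁺⊑Q)
    ... | no none              = inj₁ R⊑S
      where
      R⊑S : R ⊑ S
      R⊑S x∈R with f x∈R
      ... | Q , t , Q⊑R , x∈Q with extreme-comparable ext t
      ...   | inj₁ Q⊑S  = Q⊑S x∈Q
      ...   | inj₂ S⁺⊑Q = ⊥-elim (none (Q , S⁺⊑Q , Q⊑R))

    tower-extreme : ∀ {S} → Tower S → Extreme S
    tower-extreme (step {S} t) tR R⊑S⁺ with extreme-comparable (tower-extreme t) tR
    ... | inj₂ S⁺⊑R = inj₁ S⁺⊑R
    ... | inj₁ R⊑S with tower-extreme t tR R⊑S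
    ...   | inj₁ S⊑R  = inj₂ (subst (λ Q → Q ⁺ ⊑ S ⁺) (⊑-antisym S⊑R R⊑S) id)
    ...   | inj₂ R⁺⊑S = inj₂ (⊑-⁺ S ∘ R⁺⊑S)
    tower-extreme {S} (union f) {R} tR R⊑S
      with excludedMiddle {P = S ⊑ R ⊎ R ⁺ ⊑ S}
    ... | yes done = done
    ... | no ¬done = inj₁ S⊑R
      where
      S⊑R : S ⊑ R
      S⊑R x∈S with f x∈S
      ... | Q , t , Q⊑S , x∈Q with extreme-comparable (tower-extreme t) tR
      ...   | inj₂ Q⁺⊑R = Q⁺⊑R (⊑-⁺ Q x∈Q)
      ...   | inj₁ R⊑Q with tower-extreme t tR R⊑Q
      ...     | inj₁ Q⊑R  = Q⊑R x∈Q
      ...     | inj₂ R⁺⊑Q = ⊥-elim (¬done (inj₂ (Q⊑S ∘ R⁺⊑Q)))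

    tower-comparable : ∀ {S R} → Tower S → Tower R → R ⊑ S ⊎ S ⁺ ⊑ R
    tower-comparable tS = extreme-comparable (tower-extreme tS)

    _≺_ : Rel W a
    x ≺ y = ∃[ S ] (Tower S × x ∈ᵇ S × y ∉ᵇ S)

    tower-accessible : ∀ {S} → Tower S → ∀ {x} → x ∈ᵇ S → Acc _≺_ x
    tower-accessible (step {S} t) x∈S⁺ with ⌊⌋-sound x∈S⁺
    ... | inj₁ x∈S  = tower-accessible t x∈S
    ... | inj₂ refl = acc λ (R , tR , y∈R , next∉R) →
      [ (λ R⊑S → tower-accessible t (R⊑S y∈R))
      , (λ S⁺⊑R → contradiction (S⁺⊑R (next∈⁺ S)) next∉R)
      ]′ (tower-comparable t tR)
    tower-accessible (union f) x∈S with f x∈S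
    ... | _ , t , _ , x∈R = tower-accessible t x∈R

    below : W → Subset
    below x y = ⌊ y ≺ x ⌋

    below-tower : ∀ x → Tower (below x)
    below-tower x = union λ y∈ → let (S , t , y∈S , x∉S) = ⌊⌋-sound y∈ in
      S , t , (λ z∈S → ⌊⌋-complete (S , t , z∈S , x∉S)) , y∈S

    x∉below : ∀ x → x ∉ᵇ below x
    x∉below x x∈ = let (_ , _ , x∈S , x∉S) = ⌊⌋-sound x∈ in x∉S x∈S

    -- `below x` is the largest tower member omitting x. If its successor omitted x too, the
    -- adjoined point would already lie in `below x`.
    x∈below⁺ : ∀ x → x ∈ᵇ below x ⁺
    x∈below⁺ x = ¬¬-elim λ x∉ → next∉ (below x) (x∉below x)
      (⌊⌋-complete (below x ⁺ , step (below-tower x) , next∈⁺ (below x) , x∉))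

    ≺-wellFounded : WellFounded _≺_
    ≺-wellFounded x = tower-accessible (step (below-tower x)) (x∈below⁺ x)

    ≺-connex : ∀ {x y} → x ≢ y → x ≺ y ⊎ y ≺ x
    ≺-connex {x} {y} x≢y with excludedMiddle {P = y ≺ x}
    ... | yes y≺x = inj₂ y≺x
    ... | no  y⊀x = inj₁ (below x ⁺ , step (below-tower x) , x∈below⁺ x , y∉below⁺)
      where
      x≡next : x ≡ next (below x)
      x≡next = [ (λ x∈ → contradiction x∈ (x∉below x)) , id ]′ (⌊⌋-sound (x∈below⁺ x))

      y∉below⁺ : y ∉ᵇ below x ⁺
      y∉below⁺ y∈ = [ y⊀x ∘ ⌊⌋-sound , (λ y≡ → x≢y (trans x≡next (sym y≡))) ]′ (⌊⌋-sound y∈)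

  -- Initial ordinals and transversals by transfinite recursion.

  InjectsBelow : {W : Set a} → Rel W r → Pred W _
  InjectsBelow {W = W} _<_ w = Σ (W → W) λ k → Injective _≡_ _≡_ k × (∀ v → k v < w)

  -- The order type is an initial ordinal: W has larger cardinality than each of its proper initial
  -- segments.
  InitialOrder : {W : Set a} → Rel W r → Set _
  InitialOrder _<_ =
    WellFounded _<_ × (∀ {x y} → x ≢ y → x < y ⊎ y < x) × (∀ w → ¬ InjectsBelow _<_ w)

  -- If W injects into a proper initial segment, pull the order back along an
  -- injection into the least such segment.
  initialOrder : {W : Set a} → W → Σ (Rel W a) InitialOrder
  initialOrder {W = W} w₀ with excludedMiddle {P = ∃ (InjectsBelow (Zermelo._≺_ w₀))}
  ... | no none =
    _≺_ , ≺-wellFounded , ≺-connex , λ w inj → none (w , inj)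
    where open Zermelo w₀
  ... | yes large with minimal (Zermelo.≺-wellFounded w₀) _ large
  ...   | w , (k , k-inj , k<w) , least =
    (_≺_ on k) , On.wellFounded k ≺-wellFounded , (λ x≢y → ≺-connex (x≢y ∘ k-inj)) ,
    λ v (l , l-inj , l<v) → least (k<w v) (k ∘ l , l-inj ∘ k-inj , l<v)
    where open Zermelo w₀

  module _ {W : Set a} {I : Set b} (A : W → Pred I c) (h : W → W → I)
           (h-inj : ∀ w → Injective _≡_ _≡_ (h w)) (h∈A : ∀ w v → h w v ∈ A w) where

    -- At stage w the values already used are indexed by a proper initial segment, too small to
    -- exhaust the candidates `h w v`, of which there are as many as elements of W.
    transversal : W → ∃[ g ] (Injective _≡_ _≡_ g × (∀ w → g w ∈ A w))
    transversal w₀ with initialOrder w₀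
    ... | _<_ , wf , connex , initial = g , g-inj , λ w → proj₁ (g-fresh w)
      where
      Fresh : ∀ w → WfRec _<_ (λ _ → I) w → Pred I _
      Fresh w prev i = i ∈ A w × (∀ {v} (v<w : v < w) → prev v<w ≢ i)

      choose : ∀ w → WfRec _<_ (λ _ → I) w → I
      choose w prev with excludedMiddle {P = ∃ (Fresh w prev)}
      ... | yes (i , _) = i
      -- Arbitrary default; `∃fresh` shows that the recursion defining `g` never reaches it.
      ... | no _        = h w w

      choose-fresh : ∀ w (prev : WfRec _<_ (λ _ → I) w) →
                     ∃ (Fresh w prev) → Fresh w prev (choose w prev)
      choose-fresh w prev ∃fresh with excludedMiddle {P = ∃ (Fresh w prev)}
      ... | yes (_ , fresh) = fresh
      ... | no none         = contradiction ∃fresh none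

      open FixPoint wf (λ _ → I) choose
        (λ w eq → cong (choose w)
          (implicit-extensionality extensionality (extensionality λ v<w → eq v<w)))

      g : W → I
      g = All.wfRec wf _ (λ _ → I) choose

      ∃fresh : ∀ w → ∃ (Fresh w (λ {v} _ → g v))
      ∃fresh w = ¬¬-elim λ none →
        -- If every candidate were used up, sending v to the earlier stage that took `h w v` would
        -- inject W below w.
        let taken : ∀ v → ∃[ u ] (u < w × g u ≡ h w v)
            taken v = ¬¬-elim λ free →
              none (h w v , h∈A w v , λ {u} u<w gu≡ → free (u , u<w , gu≡))
        in initial w
          ( (λ v → proj₁ (taken v))
          , (λ {x} {y} eq → h-inj w (trans (sym (proj₂ (proj₂ (taken x))))
                                      (trans (cong g eq) (proj₂ (proj₂ (taken y))))))
          , (λ v → proj₁ (proj₂ (taken v))))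

      g-fresh : ∀ w → Fresh w (λ {v} _ → g v) (g w)
      g-fresh w = subst (Fresh w _) (sym unfold-wfRec) (choose-fresh w _ (∃fresh w))

      g-inj : Injective _≡_ _≡_ g
      g-inj {x} {y} gx≡gy = ¬¬-elim λ x≢y →
        [ (λ x<y → proj₂ (g-fresh y) x<y gx≡gy)
        , (λ y<x → proj₂ (g-fresh x) y<x (sym gx≡gy))
        ]′ (connex x≢y)

-- Enumeration of pairs and rational estimates.

unpair : ℕ → ℕ × ℕ
unpair zero = 0 , 0
unpair (suc n) with unpair n
... | zero  , b = suc b , 0
... | suc a , b = a , suc b

-- `unpair` runs along the antidiagonals, so the induction is on the diagonal s and then on b: (a,
-- b+1) follows (a+1, b), and (a+1, 0) follows (0, a).
unpair-onto : ∀ s b {a} → a ℕ.+ b ≡ s → ∃[ n ] unpair n ≡ (a , b)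
unpair-onto s (suc b) {a} eq with unpair-onto s b (trans (sym (ℕ.+-suc a b)) eq)
... | n , n≡ = suc n , next
  where
  next : unpair (suc n) ≡ (a , suc b)
  next rewrite n≡ = refl
unpair-onto s zero {zero} eq = 0 , refl
unpair-onto (suc s) zero {suc a} eq
  with unpair-onto s a (trans (sym (ℕ.+-identityʳ a)) (ℕ.suc-injective eq))
... | n , n≡ = suc n , next
  where
  next : unpair (suc n) ≡ (suc a , zero)
  next rewrite n≡ = refl

radius : ℕ → ℚ
radius k = mkℚ (+ 1) k (1-coprimeTo (suc k))

0<radius : ∀ k → 0ℚ < radius k
0<radius k = ℚ.positive⁻¹ (radius k)

-- `radius k` is 1/(k+1), since `mkℚ` stores the denominator minus one; a positive rational is at
-- least the reciprocal of its own denominator.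
radius-≤ : ∀ {ε} → 0ℚ < ε → ∃[ k ] radius k ≤ ε
radius-≤ {mkℚ (+ zero)     k _} (*<* 0<0) = contradiction 0<0 (ℤ.<-irrefl refl)
radius-≤ {mkℚ (+ suc n)    k _} _ =
  k , *≤* (ℤ.*-monoʳ-≤-nonNeg (+ suc k) (ℤ.+≤+ (s≤s (z≤n {n}))))
radius-≤ {mkℚ (ℤ.-[1+ n ]) k _} (*<* ())

radius-< : ∀ {ε} → 0ℚ < ε → ∃[ k ] radius k < ε
radius-< 0<ε with ℚ.<-dense 0<ε
... | _ , 0<δ , δ<ε with radius-≤ 0<δ
...   | k , r≤δ = k , ℚ.≤-<-trans r≤δ δ<ε

halve : ∀ {ε} → 0ℚ < ε → ∃[ δ ] (0ℚ < δ × δ + δ ≡ ε)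
halve {ε} 0<ε = ½ * ε ,
  subst (_< ½ * ε) (ℚ.*-zeroʳ ½) (ℚ.*-monoʳ-<-pos ½ 0<ε) ,
  trans (sym (ℚ.*-distribʳ-+ ε ½ ½)) (ℚ.*-identityˡ ε)

p+[q-p]≡q : ∀ p q → p + (q - p) ≡ q
p+[q-p]≡q p q = trans (sym (ℚ.+-assoc p q (ℚ.- p))) (xyx⁻¹≈y ℚ.+-0-abelianGroup p q)

p<q⇒0<q-p : ∀ {p q} → p < q → 0ℚ < q - p
p<q⇒0<q-p {p} {q} p<q = subst (_< q - p) (ℚ.+-inverseʳ p) (ℚ.+-monoˡ-< (ℚ.- p) p<q)

-- Closed sets, balls and Borel sets in a Polish space.

module MetricProperties {X : Set ℓ} (M : Metric X) where
  open Metric M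

  d-refl : ∀ {x ε} → 0ℚ < ε → d x x <ᵣ ε
  d-refl {x} = proj₂ (Equivalence.from (zero⇔≡ x x) refl)

  d-sym : ∀ {x y ε} → d x y <ᵣ ε → d y x <ᵣ ε
  d-sym {x} {y} = proj₁ (symm x y)

  d-triangle : ∀ {x y z δ ε} → d x y <ᵣ δ → d y z <ᵣ ε → d x z <ᵣ δ + ε
  d-triangle {x} {y} {z} {δ} {ε} xy yz = triangle x y z (δ , ε , xy , yz , ℚ.≤-refl)

module _ (classical : ClassicalSetTheory) where
  open Classical classical

  module PolishProperties {X : Set ℓ} (T : Topology X) (polish : IsPolish T) (x₀ : X) where
    open Topology T
    open Metric (proj₁ (proj₂ polish))
    open MetricProperties (proj₁ (proj₂ polish))

    complete : Complete
    complete = proj₁ (proj₂ (proj₂ polish))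

    induces : Induces T (proj₁ (proj₂ polish))
    induces = proj₂ (proj₂ (proj₂ polish))

    Separated : X → Pred X ℓ → Set ℓ
    Separated x F = ∃[ ε ] (0ℚ < ε × (∀ y → d x y <ᵣ ε → y ∉ F))

    closed⇒separated : ∀ {F} → Closed F → ∀ {x} → x ∉ F → Separated x F
    closed⇒separated {F} cF = Equivalence.to (induces (∁ F)) cF _

    separated⇒closed : ∀ {F} → (∀ {x} → x ∉ F → Separated x F) → Closed F
    separated⇒closed {F} sep = Equivalence.from (induces (∁ F)) (λ _ → sep)

    ∩-closed : ∀ {F G} → Closed F → Closed G → Closed (F ∩ G)
    ∩-closed {F} {G} cF cG = separated⇒closed sep
      where
      sep : ∀ {x} → x ∉ F ∩ G → Separated x (F ∩ G)
      sep {x} x∉ with excludedMiddle {P = x ∈ F}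
      ... | no x∉F = let (ε , 0<ε , h) = closed⇒separated cF x∉F in
        ε , 0<ε , λ y xy → h y xy ∘ proj₁
      ... | yes x∈F = let (ε , 0<ε , h) = closed⇒separated cG (λ x∈G → x∉ (x∈F , x∈G)) in
        ε , 0<ε , λ y xy → h y xy ∘ proj₂

    closed-limit : ∀ {F s x N} → Closed F → s ConvergesTo x →
                   (∀ {n} → N ℕ.≤ n → s n ∈ F) → x ∈ F
    closed-limit {F} {s} {x} {N} cF lim s∈F = ¬¬-elim λ x∉F →
      let (ε , 0<ε , h) = closed⇒separated cF x∉F
          (M , near)    = lim ε 0<ε
      in h _ (d-sym (near (M ℕ.⊔ N) (ℕ.m≤m⊔n M N))) (s∈F (ℕ.m≤n⊔m M N))

    private
      D : Pred X ℓ
      D = proj₁ (proj₁ polish)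

      code : X → ℕ
      code = proj₁ (proj₁ (proj₂ (proj₁ polish)))

      code-inj : ∀ {x y} → x ∈ D → y ∈ D → code x ≡ code y → x ≡ y
      code-inj = proj₂ (proj₁ (proj₂ (proj₁ polish)))

      dense : Dense D
      dense = proj₂ (proj₂ (proj₁ polish))

    centre : ℕ → X
    centre n with excludedMiddle {P = ∃[ x ] (x ∈ D × code x ≡ n)}
    ... | yes (x , _) = x
    ... | no _        = x₀

    centre-code : ∀ {x} → x ∈ D → centre (code x) ≡ x
    centre-code {x} x∈D with excludedMiddle {P = ∃[ y ] (y ∈ D × code y ≡ code x)}
    ... | yes (_ , y∈D , eq) = code-inj y∈D x∈D eq
    ... | no none            = ⊥-elim (none (x , x∈D , refl))

    abstract
      -- A closed ball: d ≤ r is expressed as d < q for all rational q > r, because `<ᵣ` compares a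
      -- real with a rational from above.
      Ball : ℕ → ℕ → Pred X ℓ
      Ball n k x = Lift ℓ (∀ {q} → radius k < q → d (centre n) x <ᵣ q)

      ball-closed : ∀ n k → Closed (Ball n k)
      ball-closed n k = separated⇒closed sep
        where
        sep : ∀ {x} → x ∉ Ball n k → Separated x (Ball n k)
        sep {x} x∉ = ¬¬-elim λ notSep → x∉ (lift λ {q} r<q → ¬¬-elim λ far →
          let (p , r<p , p<q) = ℚ.<-dense r<q in
          -- A point of the ball within q - p of x would put x at distance less than p + (q - p) = q
          -- from the centre.
          notSep (q - p , p<q⇒0<q-p p<q , λ y xy (lift y∈) →
            far (subst (d (centre n) x <ᵣ_) (p+[q-p]≡q p q)
                  (d-triangle (y∈ r<p) (d-sym xy)))))

      ball-small : ∀ {ε} → 0ℚ < ε →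
                   ∃[ k ] (∀ {n x y} → x ∈ Ball n k → y ∈ Ball n k → d x y <ᵣ ε)
      ball-small 0<ε with halve 0<ε
      ... | δ , 0<δ , refl with radius-< 0<δ
      ...   | k , r<δ = k , λ (lift x∈) (lift y∈) → d-triangle (d-sym (x∈ r<δ)) (y∈ r<δ)

      balls-cover : ∀ k x → ∃[ n ] x ∈ Ball n k
      balls-cover k x with dense U U-open (x , lift (d-refl (0<radius k)))
        where
        U : Pred X ℓ
        U y = Lift ℓ (d x y <ᵣ radius k)

        U-open : Open U
        U-open = Equivalence.from (induces U) λ y (lift xy) →
          let (q , q<r , xy<q) = rounded (d x y) xy in
          radius k - q , p<q⇒0<q-p q<r , λ z yz →
            lift (subst (d x z <ᵣ_) (p+[q-p]≡q q (radius k)) (d-triangle xy<q yz))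
      ... | y , y∈D , lift xy = code y ,
        subst (λ c → Lift ℓ (∀ {q} → radius k < q → d c x <ᵣ q)) (sym (centre-code y∈D))
          (lift λ r<q → up-closed (d y x) (ℚ.<⇒≤ r<q) (d-sym xy))

      Base : ℕ → Pred X ℓ
      Base m = Ball (proj₁ (unpair m)) (proj₂ (unpair m))

      base-closed : ∀ m → Closed (Base m)
      base-closed m = ball-closed (proj₁ (unpair m)) (proj₂ (unpair m))

      -- The balls form a countable closed network: x has a positive distance ε from F, and a ball
      -- through x of diameter below ε misses F.
      base-separates : ∀ {F x} → Closed F → x ∉ F → ∃[ m ] (x ∈ Base m × ¬ (F ≬ Base m))
      base-separates {F} {x} cF x∉F =
        let (ε , 0<ε , h) = closed⇒separated cF x∉F
            (k , small)   = ball-small 0<ε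
            (n , x∈)      = balls-cover k x
            (m , m≡)      = unpair-onto _ k refl
            back          = subst (λ (n , k) → ∀ {y} → Ball n k y → y ∈ Base m) m≡ id
            forth         = subst (λ (n , k) → ∀ {y} → y ∈ Base m → Ball n k y) m≡ id
        in m , back x∈ , λ (y , y∈F , y∈) → h y (small x∈ (forth y∈)) y∈F

    borel-∩ : ∀ {A B} → Borel A → Borel B → Borel (A ∩ B)
    borel-∩ {A} {B} bA bB = resp-≐ (to , from) (complement (union C bC))
      where
      C : ℕ → Pred X ℓ
      C zero    = ∁ A
      C (suc _) = ∁ B

      bC : ∀ n → Borel (C n)
      bC zero    = complement bA
      bC (suc _) = complement bB

      to : ∁ (⋃ ℕ C) ⊆ A ∩ B
      to x∉ = ¬¬-elim (λ x∉A → x∉ (0 , x∉A)) , ¬¬-elim (λ x∉B → x∉ (1 , x∉B))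

      from : A ∩ B ⊆ ∁ (⋃ ℕ C)
      from (x∈A , x∈B) (zero  , x∉A) = x∉A x∈A
      from (x∈A , x∈B) (suc _ , x∉B) = x∉B x∈B

    borel-closed : ∀ {F} → Closed F → Borel F
    borel-closed cF = resp-≐ (¬¬-elim , λ x∈F x∉F → x∉F x∈F) (complement (open-set cF))

  -- Positive sets and saturations of balls.

  module Selection (S : PolishIdealSpace ℓ) where
    open PolishIdealSpace S

    point : X
    point = ¬¬-elim λ none → null-proper λ A → null-empty λ x → ⊥-elim (none x)

    open PolishProperties topology polish point public

    positive-⋃ : ∀ {F} → Positive F → (G : ℕ → Pred X ℓ) → F ⊆ ⋃ ℕ G → ∃[ n ] Positive (G n)
    positive-⋃ pF G F⊆ = ¬¬-elim λ none →
      pF (null-⊆ F⊆ (null-⋃ G λ n → ¬¬-elim λ pG → none (n , pG)))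

    positive⇒satisfiable : ∀ {F} → Positive F → Satisfiable F
    positive⇒satisfiable pF = ¬¬-elim λ none → pF (null-empty λ x x∈F → none (x , x∈F))

    module _ (inner : ∀ B → Borel₊ B → ∃[ F ] (Closed F × Positive F × F ⊆ B))
             (𝒜 : Partition X) (measurable : StronglyBorelMeasurable topology 𝒜)
             (pieces : ∀ i → Closed (Partition.piece 𝒜 i) × Null (Partition.piece 𝒜 i)) where
      open Partition 𝒜

      private
        Code : Set
        Code = ℕ → Bool

      index : X → Index
      index x = proj₁ (covers x)

      index-≬ : ∀ {x} {F : Pred X ℓ} → x ∈ F → piece (index x) ≬ F
      index-≬ {x} x∈F = x , proj₂ (covers x) , x∈F

      index-unique : ∀ {i x} → x ∈ piece i → i ≡ index x
      index-unique {x = x} x∈ = disjoint (x , x∈ , proj₂ (covers x))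

      Sat : ℕ → Pred X ℓ
      Sat m = saturation (Base m)

      sat-borel : ∀ m → Borel (Sat m)
      sat-borel m = measurable (Base m) (base-closed m)

      sat⇒≬ : ∀ {m x} → x ∈ Sat m → piece (index x) ≬ Base m
      sat⇒≬ {m} (i , meets , x∈) = subst (λ j → piece j ≬ Base m) (index-unique x∈) meets

      sat-invariant : ∀ {m x y} → index x ≡ index y → x ∈ Sat m → y ∈ Sat m
      sat-invariant {m} {x} {y} eq x∈ = index y ,
        subst (λ j → piece j ≬ Base m) eq (sat⇒≬ x∈) , proj₂ (covers y)

      -- The piece of x is closed, so some ball contains y and misses that whole piece.
      sat-separates : ∀ {x y} → y ∉ piece (index x) → ∃[ m ] (y ∈ Sat m × x ∉ Sat m)
      sat-separates {x} {y} y∉ =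
        let (m , y∈ , misses) = base-separates (proj₁ (pieces (index x))) y∉ in
        m , (index y , index-≬ y∈ , proj₂ (covers y)) , λ x∈ → misses (sat⇒≬ x∈)

      -- Splitting a positive closed set.

      record Closed₊ : Set (Level.suc ℓ) where
        constructor closed₊
        field
          set        : Pred X ℓ
          isClosed   : Closed set
          isPositive : Positive set

      open Closed₊

      Splits : Closed₊ → ℕ → Set (Level.suc ℓ)
      Splits F m = Positive (set F ∩ Sat m) × Positive (set F ∩ ∁ (Sat m))

      abstract
        split : ∀ F → ∃ (Splits F)
        split F = ¬¬-elim λ unsplit → isPositive F (F-null (side unsplit))
          where
          -- N is whichever side of `Sat m` in F is null; the condition hides which one and says
          -- that `Sat m` separates no two points of F outside N.
          NullSide : ℕ → Set (Level.suc ℓ)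
          NullSide m = Σ (Pred X ℓ) λ N →
            Null N × (∀ {x y} → x ∈ set F → y ∈ set F → y ∈ Sat m → x ∉ Sat m → x ∈ N ⊎ y ∈ N)

          side : ¬ ∃ (Splits F) → ∀ m → NullSide m
          side unsplit m with excludedMiddle {P = Null (set F ∩ Sat m)}
          ... | yes null = _ , null , λ _ y∈F y∈ _ → inj₂ (y∈F , y∈)
          ... | no pos   = set F ∩ ∁ (Sat m) , ¬¬-elim (λ pos′ → unsplit (m , pos , pos′)) ,
                           λ x∈F _ _ x∉ → inj₁ (x∈F , x∉)

          F-null : (∀ m → NullSide m) → Null (set F)
          F-null N with excludedMiddle {P = Satisfiable (set F ∩ ∁ (⋃ ℕ (proj₁ ∘ N)))}
          ... | no none = null-⊆ (λ {x} x∈F → ¬¬-elim λ x∉ → none (x , x∈F , x∉))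
                                 (null-⋃ _ (proj₁ ∘ proj₂ ∘ N))
          ... | yes (x , x∈F , x∉N) = null-⊆ F⊆ (null-⋃ N′ N′-null)
            where
            N′ : ℕ → Pred X ℓ
            -- Here x is a point of F outside all the null sides. Any other such point lies in the
            -- piece of x, so adding this null piece covers F.
            N′ zero    = piece (index x)
            N′ (suc m) = proj₁ (N m)

            N′-null : ∀ m → Null (N′ m)
            N′-null zero    = proj₂ (pieces (index x))
            N′-null (suc m) = proj₁ (proj₂ (N m))

            F⊆ : set F ⊆ ⋃ ℕ N′
            F⊆ y∈F = ¬¬-elim λ y∉ →
              let (m , y∈ , x∉) = sat-separates (λ y∈ → y∉ (0 , y∈)) in
              [ (λ x∈N → x∉N (m , x∈N)) , (λ y∈N → y∉ (suc m , y∈N)) ]′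
                (proj₂ (proj₂ (N m)) x∈F y∈F y∈ x∉)

        -- Countably many balls of index k cover a positive closed subset of A, so one of them meets
        -- it in a positive set.
        refine : ∀ {A} → Borel₊ A → ∀ k → Σ Closed₊ λ F → set F ⊆ A × ∃[ n ] set F ⊆ Ball n k
        refine bA k with inner _ bA
        ... | F , cF , pF , F⊆A
          with positive-⋃ pF (λ n → F ∩ Ball n k)
                 (λ {x} x∈F → let (n , x∈) = balls-cover k x in n , x∈F , x∈)
        ...   | n , pos = closed₊ (F ∩ Ball n k) (∩-closed cF (ball-closed n k)) pos ,
                          F⊆A ∘ proj₁ , n , proj₂

      -- The Cantor scheme and its branches.

      half : Closed₊ → Bool → Pred X ℓ
      half F true  = set F ∩ Sat (proj₁ (split F))
      half F false = set F ∩ ∁ (Sat (proj₁ (split F)))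

      half-borel₊ : ∀ F b → Borel₊ (half F b)
      half-borel₊ F true  = borel-∩ (borel-closed (isClosed F)) (sat-borel _) ,
                            proj₁ (proj₂ (split F))
      half-borel₊ F false = borel-∩ (borel-closed (isClosed F)) (complement (sat-borel _)) ,
                            proj₂ (proj₂ (split F))

      half-⊆ : ∀ F b → half F b ⊆ set F
      half-⊆ F true  = proj₁
      half-⊆ F false = proj₁

      half-separated : ∀ F {b c x y} → x ∈ half F b → y ∈ half F c → index x ≡ index y → b ≡ c
      half-separated F {true}  {true}  _ _ _ = refl
      half-separated F {true}  {false} (_ , x∈) (_ , y∉) eq = contradiction (sat-invariant eq x∈) y∉
      half-separated F {false} {true}  (_ , x∉) (_ , y∈) eq =
        contradiction (sat-invariant (sym eq) y∈) x∉
      half-separated F {false} {false} _ _ _ = refl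

      -- The scheme read along the branch p; level n depends on the first n digits only.
      node : Closed₊ → Code → ℕ → Closed₊
      node F p zero    = F
      node F p (suc n) = proj₁ (refine (half-borel₊ (node F p n) (p n)) n)

      node-half : ∀ F p n → set (node F p (suc n)) ⊆ half (node F p n) (p n)
      node-half F p n = proj₁ (proj₂ (refine (half-borel₊ (node F p n) (p n)) n))

      node-ball : ∀ F p n → ∃[ m ] set (node F p (suc n)) ⊆ Ball m n
      node-ball F p n = proj₂ (proj₂ (refine (half-borel₊ (node F p n) (p n)) n))

      node-antitone : ∀ F p {m n} → m ℕ.≤′ n → set (node F p n) ⊆ set (node F p m)
      node-antitone F p ℕ.≤′-refl = id
      node-antitone F p (ℕ.≤′-step {n} m≤n) =
        node-antitone F p m≤n ∘ half-⊆ (node F p n) (p n) ∘ node-half F p n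

      branch : ∀ F p → ∃[ x ] (∀ n → x ∈ set (node F p n))
      branch F p = proj₁ limit , λ n →
        closed-limit (isClosed (node F p n)) (proj₂ limit) (s∈node n)
        where
        open Metric (proj₁ (proj₂ polish))

        s : ℕ → X
        s n = proj₁ (positive⇒satisfiable (isPositive (node F p n)))

        s∈node : ∀ n {m} → n ℕ.≤ m → s m ∈ set (node F p n)
        s∈node n {m} n≤m = node-antitone F p (ℕ.≤⇒≤′ n≤m)
          (proj₂ (positive⇒satisfiable (isPositive (node F p m))))

        cauchy : Cauchy s
        cauchy ε 0<ε = let (k , small) = ball-small 0<ε ; (_ , ⊆Ball) = node-ball F p k in
          -- The ball of index k is imposed in passing from level k to level k + 1, hence `suc k`.
          suc k , λ m n k<m k<n → small (⊆Ball (s∈node (suc k) k<m)) (⊆Ball (s∈node (suc k) k<n))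

        limit : ∃[ x ] s ConvergesTo x
        limit = complete s cauchy

      branchIndex : Closed₊ → Code → Index
      branchIndex F p = index (proj₁ (branch F p))

      branchIndex-≬ : ∀ F p → piece (branchIndex F p) ≬ set F
      branchIndex-≬ F p = index-≬ (proj₂ (branch F p) 0)

      -- While the nodes agree, the two limit points lie in halves of one node and in the same
      -- piece, so the next digits agree, and with them the next nodes.
      branchIndex-injective : ∀ F → Injective _≡_ _≡_ (branchIndex F)
      branchIndex-injective F {p} {q} eq =
        extensionality λ n → same-digit n (same-node n)
        where
        same-digit : ∀ n → node F p n ≡ node F q n → p n ≡ q n
        same-digit n n≡ = half-separated (node F q n)
          (subst (λ G → _ ∈ half G (p n)) n≡ (node-half F p n (proj₂ (branch F p) (suc n))))
          (node-half F q n (proj₂ (branch F q) (suc n))) eq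

        same-node : ∀ n → node F p n ≡ node F q n
        same-node zero    = refl
        same-node (suc n) = cong-step (same-node n) (same-digit n (same-node n))
          where
          cong-step : ∀ {G H b c} → G ≡ H → b ≡ c →
                      proj₁ (refine (half-borel₊ G b) n) ≡ proj₁ (refine (half-borel₊ H c) n)
          cong-step refl refl = refl

      -- Coding closed sets and the Bernstein construction.

      trace : Closed₊ → Code
      trace F m = ⌊ set F ≬ Base m ⌋

      -- A ball through a point of F that misses G would distinguish the traces. Thus a closed set
      -- is determined by its trace, which bounds the number of closed sets by 2^ℕ.
      trace-⊆ : ∀ F G → trace F ≡ trace G → set F ⊆ set G
      trace-⊆ F G eq {x} x∈F = ¬¬-elim λ x∉G →
        let (m , x∈ , misses) = base-separates (isClosed G) x∉G in
        misses (⌊⌋-sound (trans (sym (cong (λ c → c m) eq)) (⌊⌋-complete (x , x∈F , x∈))))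

      -- Default for codes that are not traces: the recursion needs a positive closed set at every
      -- code.
      whole : Closed₊
      whole = closed₊ (λ _ → Lift ℓ ⊤)
        (separated⇒closed λ x∉ → contradiction _ x∉)
        (λ null → null-proper λ A → null-⊆ _ null)

      -- The digit 0 of a code is left free, so that every closed set gets two codes.
      representative : Code → Closed₊
      representative w with excludedMiddle {P = ∃[ F ] trace F ≡ w ∘ suc}
      ... | yes (F , _) = F
      ... | no _        = whole

      representative-⊆ : ∀ w F → trace F ≡ w ∘ suc → set (representative w) ⊆ set F
      representative-⊆ w F eq with excludedMiddle {P = ∃[ G ] trace G ≡ w ∘ suc}
      ... | yes (G , eq′) = trace-⊆ G F (trans eq′ (sym eq))
      ... | no none       = ⊥-elim (none (F , eq))

      -- All F with the given trace have the same points; a code that gives no trace imposes no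
      -- condition.
      Meets : Code → Pred Index _
      Meets w i = ∀ F → trace F ≡ w ∘ suc → piece i ≬ set F

      abstract
        bernstein : ∃[ g ] (Injective _≡_ _≡_ g × (∀ w → g w ∈ Meets w))
        bernstein = transversal Meets (branchIndex ∘ representative)
          -- The constant code only witnesses that `Code` is inhabited.
          (branchIndex-injective ∘ representative) meets (λ _ → true)
          where
          meets : ∀ w v → branchIndex (representative w) v ∈ Meets w
          meets w v F eq with branchIndex-≬ (representative w) v
          ... | x , x∈i , x∈ = x , x∈i , representative-⊆ w F eq x∈

      infixr 5 _◂_

      _◂_ : Bool → Code → Code
      (b ◂ p) zero    = b
      (b ◂ p) (suc n) = p n

      nonmeasurable : Σ (Pred Index ℓ) λ 𝒜₀ → CompletelyNonmeasurable ⋃[ 𝒜₀ ]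
      nonmeasurable = 𝒜₀ , split-by
        where
        g : Code → Index
        g = proj₁ bernstein

        g-injective : Injective _≡_ _≡_ g
        g-injective = proj₁ (proj₂ bernstein)

        g-meets : ∀ b F → piece (g (b ◂ trace F)) ≬ set F
        g-meets b F = proj₂ (proj₂ bernstein) (b ◂ trace F) F refl

        -- Of the two pieces reserved for each closed set, the one with digit 0 equal to `true` is
        -- selected.
        𝒜₀ : Pred Index ℓ
        𝒜₀ i = ∃[ w ] (w 0 ≡ true × i ≡ g w)

        g-avoids : ∀ {w x} → w 0 ≡ false → x ∈ piece (g w) → x ∉ ⋃[ 𝒜₀ ]
        g-avoids {w} {x} w0 x∈w (i , (v , v0 , i≡) , x∈i) =
          contradiction (trans (sym v0) (trans (cong (λ u → u 0) v≡w) w0)) λ ()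
          where
          v≡w : v ≡ w
          -- Pieces sharing a point coincide, so injectivity of `g` would identify codes with
          -- different digits 0.
          v≡w = g-injective (trans (sym i≡) (disjoint (x , x∈i , x∈w)))

        split-by : CompletelyNonmeasurable ⋃[ 𝒜₀ ]
        split-by B bB =
          let (F , cF , pF , F⊆B) = inner B bB
              C                   = closed₊ F cF pF
              (x , x∈i , x∈F)     = g-meets true C
              (y , y∈j , y∈F)     = g-meets false C
          in (x , (_ , (true ◂ trace C , refl , refl) , x∈i) , F⊆B x∈F) ,
             (y , g-avoids refl y∈j , F⊆B y∈F)

theorem2p1 : ClassicalSetTheory →
    {ℓ : Level} (S : PolishIdealSpace ℓ) →
    let open PolishIdealSpace S in
    (∀ B → Borel₊ B → ∃[ F ] (Closed F × Positive F × F ⊆ B)) →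
    (𝒜 : Partition X) →
    let open Partition 𝒜 in
    StronglyBorelMeasurable topology 𝒜 →
    (∀ i → Closed (piece i) × Null (piece i)) →
    Σ (Pred Index ℓ) λ 𝒜₀ → CompletelyNonmeasurable ⋃[ 𝒜₀ ]
theorem2p1 classical S = Selection.nonmeasurable classical S
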